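{- If $G$ is a graph with no isolated vertices and total domination number $\gamma_t(G) = 3$, then $\gamma_{\rm gr}^t(G) > 3$.
   Context: All graphs are finite, simple, without isolated vertices. $\gamma_t(G)$ is the minimum size of a set $D$ of vertices such that every vertex of $G$ has a neighbor in $D$. $N(v)$ denotes the open neighborhood of $v$. A sequence $S=(v_1,\ldots,v_k)$ of distinct vertices of $G$ is a legal (open neighborhood) sequence if $N(v_i)\setminus \bigcup_{j=1}^{i-1} N(v_j)\neq\emptyset$ for every $i\in\{2,\ldots,k\}$. It is a total dominating sequence if moreover the set $\{v_1,\ldots,v_k\}$ is a total dominating set of $G$. The Grundy total domination number $\gamma_{\rm gr}^t(G)$ is the maximum length of a total dominating sequence of $G$. -}

module Defs where

open import Data.Fin.Base as Fin using (Fin; zero; suc; toℕ; fromℕ; inject₁)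
import Data.Fin.Properties as Fin
open import Data.Fin.Relation.Unary.Top using (view; ‵fromℕ; ‵inject₁)
open import Data.Fin.Subset as Subset using (Subset; ∣_∣)
import Data.Fin.Subset.Properties as Subset
open import Data.Nat.Base using (ℕ; zero; suc; _≤_; _<_)
open import Data.Nat.Induction using (<-rec)
import Data.Nat.Properties as ℕ
open import Data.Product.Base using (∃; _×_; _,_; proj₁; proj₂)
open import Data.Vec.Base using (Vec; []; _∷_; _∷ʳ_; lookup)
import Data.Vec.Membership.DecPropositional as VecMembership
open import Data.Vec.Membership.Propositional.Properties using (∈-lookup)
open import Data.Vec.Relation.Unary.All using (All; []; _∷_)
open import Data.Vec.Relation.Unary.AllPairs using (allPairs?; []; _∷_)
open import Data.Vec.Relation.Unary.Any using (here; there)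
open import Data.Vec.Relation.Unary.Unique.Propositional using (Unique)
open import Data.Vec.Relation.Unary.Unique.Propositional.Properties
  using (lookup-injective)
open import Level using (0ℓ)
open import Relation.Binary.Core using (Rel)
import Relation.Binary.Definitions as Binary
open import Relation.Binary.PropositionalEquality
  using (_≡_; refl; sym; subst)
open import Relation.Nullary.Decidable
  using (Dec; yes; no; map′; ¬?; _×-dec_; _→-dec_)
open import Relation.Nullary.Negation using (contradiction)
open import Relation.Unary using (Pred; Decidable; _∈_; _∉_)

private
  module ∈ᵛ {n} = VecMembership (Fin._≟_ {n})

IsMinimum : Pred ℕ 0ℓ → Pred ℕ 0ℓ
IsMinimum P m = P m × (∀ {k} → P k → m ≤ k)

IsMaximum : Pred ℕ 0ℓ → Pred ℕ 0ℓ
IsMaximum P m = P m × (∀ {k} → P k → k ≤ m)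

minimum : ∀ {P} → Decidable P → ∃ P → ∃ (IsMinimum P)
minimum {P} P? (b , pb) = <-rec (λ b → P b → ∃ (IsMinimum P)) step b pb
  where
  step : ∀ b → (∀ {m} → m < b → P m → ∃ (IsMinimum P)) → P b → ∃ (IsMinimum P)
  step b rec pb with ℕ.anyUpTo? P? b
  ... | yes (m , m<b , pm) = rec m<b pm
  ... | no ¬smaller = b , pb , λ {k} pk → ℕ.≮⇒≥ λ k<b → ¬smaller (k , k<b , pk)

maximum : ∀ {P} → Decidable P → ∀ b → (∀ {k} → P k → k ≤ b) → ∃ P →
          ∃ (IsMaximum P)
maximum {P} P? b bound (k , pk) with P? b
... | yes pb = b , pb , bound
maximum {P} P? zero bound (k , pk) | no ¬pb =
  contradiction (subst P (ℕ.n≤0⇒n≡0 (bound pk)) pk) ¬pb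
maximum {P} P? (suc b) bound (k , pk) | no ¬pb =
  maximum P? b
    (λ {j} pj → ℕ.≤-pred (ℕ.≤∧≢⇒< (bound pj) λ { refl → ¬pb pj }))
    (k , pk)

anyVec? : ∀ {n} k {P : Pred (Vec (Fin n) k) 0ℓ} → Decidable P → Dec (∃ P)
anyVec? zero    P? = map′ ([] ,_) (λ { ([] , p) → p }) (P? [])
anyVec? (suc k) P? =
  map′ (λ (x , xs , p) → x ∷ xs , p) (λ { (x ∷ xs , p) → x , xs , p })
       (Fin.any? λ x → anyVec? k λ xs → P? (x ∷ xs))

-- A finite simple graph with vertex set Fin n.
record Graph (n : ℕ) : Set₁ where
  field
    Adj    : Rel (Fin n) 0ℓ
    adj?   : Binary.Decidable Adj
    symm   : Binary.Symmetric Adj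
    irrefl : Binary.Irreflexive _≡_ Adj

  N : Fin n → Pred (Fin n) 0ℓ
  N v = Adj v

NoIsolatedVertices : ∀ {n} → Graph n → Set
NoIsolatedVertices G = ∀ v → ∃ λ u → u ∈ N v
  where open Graph G

module _ {n : ℕ} (G : Graph n) where
  open Graph G

  IsTotalDominating : Pred (Fin n) 0ℓ → Set
  IsTotalDominating D = ∀ v → ∃ λ u → u ∈ N v × u ∈ D

  -- Indices start at 0, so the indices i with 0 < toℕ i are those of the
  -- second and later terms. The inner existential says that u belongs to
  -- the neighborhood of the i-th term minus the union of the earlier ones.
  IsLegal : ∀ {k} → Vec (Fin n) k → Set
  IsLegal {k} S = Unique S ×
    (∀ (i : Fin k) → 0 < toℕ i →
      ∃ λ u → u ∈ N (lookup S i) ×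
              (∀ (j : Fin k) → j Fin.< i → u ∉ N (lookup S j)))

  IsTotalDominatingSequence : ∀ {k} → Vec (Fin n) k → Set
  IsTotalDominatingSequence S = IsLegal S × IsTotalDominating (∈ᵛ._∈ S)

  TotalDominatingSetOfSize : Pred ℕ 0ℓ
  TotalDominatingSetOfSize k =
    ∃ λ (D : Subset n) → IsTotalDominating (Subset._∈ D) × ∣ D ∣ ≡ k

  TotalDominatingSequenceOfLength : Pred ℕ 0ℓ
  TotalDominatingSequenceOfLength k =
    ∃ λ (S : Vec (Fin n) k) → IsTotalDominatingSequence S

  private
    LegalOfLength : Pred ℕ 0ℓ
    LegalOfLength k = ∃ λ (S : Vec (Fin n) k) → IsLegal S

  isTotalDominating? : ∀ {D} → Decidable D → Dec (IsTotalDominating D)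
  isTotalDominating? D? = Fin.all? λ v → Fin.any? λ u → adj? v u ×-dec D? u

  isLegal? : ∀ {k} (S : Vec (Fin n) k) → Dec (IsLegal S)
  isLegal? S = allPairs? (λ x y → ¬? (x Fin.≟ y)) S ×-dec
    (Fin.all? λ i → (0 ℕ.<? toℕ i) →-dec
      Fin.any? λ u → adj? (lookup S i) u ×-dec
        Fin.all? λ j → (j Fin.<? i) →-dec ¬? (adj? (lookup S j) u))

  isTotalDominatingSequence? : ∀ {k} (S : Vec (Fin n) k) →
                               Dec (IsTotalDominatingSequence S)
  isTotalDominatingSequence? S =
    isLegal? S ×-dec isTotalDominating? (∈ᵛ._∈? S)

  totalDominatingSetOfSize? : Decidable TotalDominatingSetOfSize
  totalDominatingSetOfSize? k = Subset.anySubset? λ D →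
    isTotalDominating? (Subset._∈? D) ×-dec (∣ D ∣ ℕ.≟ k)

  totalDominatingSequenceOfLength? : Decidable TotalDominatingSequenceOfLength
  totalDominatingSequenceOfLength? k = anyVec? k isTotalDominatingSequence?

  legal-length≤n : ∀ {k} {S : Vec (Fin n) k} → IsLegal S → k ≤ n
  legal-length≤n (unique , _) =
    Fin.injective⇒≤ λ {i} {j} → lookup-injective unique i j

  private
    lookup-∷ʳ-inject₁ : ∀ {k} (S : Vec (Fin n) k) w i →
                        lookup (S ∷ʳ w) (inject₁ i) ≡ lookup S i
    lookup-∷ʳ-inject₁ (x ∷ S) w zero    = refl
    lookup-∷ʳ-inject₁ (x ∷ S) w (suc i) = lookup-∷ʳ-inject₁ S w i

    lookup-∷ʳ-fromℕ : ∀ {k} (S : Vec (Fin n) k) w →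
                      lookup (S ∷ʳ w) (fromℕ k) ≡ w
    lookup-∷ʳ-fromℕ []      w = refl
    lookup-∷ʳ-fromℕ (x ∷ S) w = lookup-∷ʳ-fromℕ S w

    all-∷ʳ : ∀ {k} {P : Pred (Fin n) 0ℓ} {S : Vec (Fin n) k} {w} →
             All P S → P w → All P (S ∷ʳ w)
    all-∷ʳ []         pw = pw ∷ []
    all-∷ʳ (px ∷ pxs) pw = px ∷ all-∷ʳ pxs pw

    unique-∷ʳ : ∀ {k} {S : Vec (Fin n) k} {w} →
                Unique S → w ∈ᵛ.∉ S → Unique (S ∷ʳ w)
    unique-∷ʳ []         w∉S = [] ∷ []
    unique-∷ʳ (px ∷ pxs) w∉S =
      all-∷ʳ px (λ x≡w → w∉S (here (sym x≡w))) ∷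
      unique-∷ʳ pxs (λ w∈S → w∉S (there w∈S))

    legal-∷ʳ : ∀ {k} {S : Vec (Fin n) k} {u w} → IsLegal S → u ∈ N w →
               (∀ x → x ∈ᵛ.∈ S → u ∉ N x) → IsLegal (S ∷ʳ w)
    legal-∷ʳ {k} {S} {u} {w} (unique , legal) uw fresh =
      unique-∷ʳ unique (λ w∈S → fresh w w∈S uw) , legal′
      where
      New : Fin (suc k) → Fin n → Set
      New i u = u ∈ N (lookup (S ∷ʳ w) i) ×
                (∀ j → j Fin.< i → u ∉ N (lookup (S ∷ʳ w) j))

      legal′ : ∀ i → 0 < toℕ i → ∃ (New i)
      legal′ i 0<i with view i
      ... | ‵fromℕ = u , subst (λ x → Adj x u) (sym (lookup-∷ʳ-fromℕ S w)) uw , new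
        where
        new : ∀ j → j Fin.< fromℕ k → u ∉ N (lookup (S ∷ʳ w) j)
        new j j<k a with view j
        ... | ‵fromℕ     = ℕ.<-irrefl refl j<k
        ... | ‵inject₁ j =
          fresh _ (∈-lookup j S) (subst (λ x → Adj x u) (lookup-∷ʳ-inject₁ S w j) a)
      ... | ‵inject₁ i with legal i (subst (0 <_) (Fin.toℕ-inject₁ i) 0<i)
      ...   | z , zi , old =
        z , subst (λ x → Adj x z) (sym (lookup-∷ʳ-inject₁ S w i)) zi , new
        where
        new : ∀ j → j Fin.< inject₁ i → z ∉ N (lookup (S ∷ʳ w) j)
        new j j<i a with view j
        ... | ‵fromℕ     = ℕ.<-asym j<i (subst (toℕ (inject₁ i) <_)
                (sym (Fin.toℕ-fromℕ k))
                (subst (_< k) (sym (Fin.toℕ-inject₁ i)) (Fin.toℕ<n i)))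
        ... | ‵inject₁ j = old j
                (subst (_< toℕ i) (Fin.toℕ-inject₁ j)
                  (subst (toℕ (inject₁ j) <_) (Fin.toℕ-inject₁ i) j<i))
                (subst (λ x → Adj x z) (lookup-∷ʳ-inject₁ S w j) a)

  module _ (noIsolated : NoIsolatedVertices G) where

    totalDominatingSetExists : ∃ TotalDominatingSetOfSize
    totalDominatingSetExists = ∣ Subset.⊤ {n} ∣ , Subset.⊤ ,
      (λ v → let u , vu = noIsolated v in u , vu , Subset.∈⊤) , refl

    -- A legal sequence of maximum length is total dominating: a neighbor of
    -- an undominated vertex could be appended to it.
    totalDominatingSequenceExists : ∃ TotalDominatingSequenceOfLength
    totalDominatingSequenceExists
      with maximum {LegalOfLength} (λ k → anyVec? k isLegal?) n
             (λ (_ , legal) → legal-length≤n legal) (0 , [] , [] , λ ())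
    ... | k , (S , legal) , longest = k , S , legal , dominating
      where
      dominating : IsTotalDominating (∈ᵛ._∈ S)
      dominating v with Fin.any? (λ u → adj? v u ×-dec (u ∈ᵛ.∈? S))
      ... | yes found = found
      ... | no ¬found =
        let w , vw = noIsolated v in
        contradiction
          (longest (S ∷ʳ w ,
            legal-∷ʳ legal (symm vw) λ x x∈S xv → ¬found (x , symm xv , x∈S)))
          ℕ.1+n≰n

    minimumTotalDominatingSet : ∃ (IsMinimum TotalDominatingSetOfSize)
    minimumTotalDominatingSet =
      minimum totalDominatingSetOfSize? totalDominatingSetExists

    maximumTotalDominatingSequence :
      ∃ (IsMaximum TotalDominatingSequenceOfLength)
    maximumTotalDominatingSequence =
      maximum totalDominatingSequenceOfLength? n
        (λ (_ , legal , _) → legal-length≤n legal) totalDominatingSequenceExists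

    totalDominationNumber : ℕ
    totalDominationNumber = proj₁ minimumTotalDominatingSet

    grundyTotalDominationNumber : ℕ
    grundyTotalDominationNumber = proj₁ maximumTotalDominatingSequence

{-# OPTIONS --safe #-}

-- Let u ~ v be an edge. As {u , v} is not total dominating, some w is adjacent
-- to neither u nor v; let z be a neighbor of w. Then (w , u , v , z) is legal:
-- its terms newly dominate z, v, u and w respectively. A longest legal
-- sequence extending it is total dominating.
module Submission where

open import Defs
open import Data.Fin.Base as Fin using (Fin; zero; suc; opposite)
import Data.Fin.Properties as Fin
open import Data.Fin.Subset as Subset using (Subset; ∣_∣; _∪_; ⁅_⁆; inside; outside)
import Data.Fin.Subset.Properties as Subset
open import Data.Nat.Base using (ℕ; zero; suc; _+_; _≤_; _<_; _>_; z≤n; s≤s)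
import Data.Nat.Properties as ℕ
open import Data.Product.Base using (∃; _×_; _,_; proj₁; proj₂)
open import Data.Sum.Base using (inj₁; inj₂)
open import Data.Vec.Base using (Vec; []; _∷_; lookup; tabulate)
import Data.Vec.Membership.DecPropositional as VecMembership
open import Data.Vec.Membership.Propositional using () renaming (_∈_ to _∈ᵛ_)
open import Data.Vec.Membership.Propositional.Properties using (∈-tabulate⁺)
open import Data.Vec.Properties using (lookup∘tabulate)
open import Data.Vec.Relation.Unary.All using (All; []; _∷_)
import Data.Vec.Relation.Unary.All.Properties as All
open import Data.Vec.Relation.Unary.AllPairs using (AllPairs; []; _∷_)
import Data.Vec.Relation.Unary.Unique.Propositional.Properties as Unique
open import Relation.Binary.Core using (Rel)
open import Relation.Binary.Definitions using (tri<; tri≈; tri>)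
open import Relation.Binary.PropositionalEquality
  using (_≡_; refl; sym; cong; subst; subst₂)
open import Relation.Nullary.Decidable using (yes; no; ¬?; _×-dec_)
open import Relation.Nullary.Negation using (¬_; contradiction)

AllPairs-lookup : ∀ {a ℓ} {A : Set a} {R : Rel A ℓ} {k} {xs : Vec A k} →
                  AllPairs R xs → ∀ {i j} → i Fin.< j →
                  R (lookup xs i) (lookup xs j)
AllPairs-lookup (rs ∷ _)   {zero}  {suc j} _         = All.lookup⁺ rs j
AllPairs-lookup (_  ∷ rss) {suc i} {suc j} (s≤s i<j) = AllPairs-lookup rss i<j

opposite-anti-< : ∀ {n} {i j : Fin n} → i Fin.< j → opposite j Fin.< opposite i
opposite-anti-< {n} {i} {j} i<j =
  subst₂ _<_ (sym (Fin.opposite-prop j)) (sym (Fin.opposite-prop i))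
    (ℕ.∸-monoʳ-< (s≤s i<j) (Fin.toℕ<n j))

∣p∪q∣≤∣p∣+∣q∣ : ∀ {n} (p q : Subset n) → ∣ p ∪ q ∣ ≤ ∣ p ∣ + ∣ q ∣
∣p∪q∣≤∣p∣+∣q∣ []            []            = z≤n
∣p∪q∣≤∣p∣+∣q∣ (outside ∷ p) (outside ∷ q) = ∣p∪q∣≤∣p∣+∣q∣ p q
∣p∪q∣≤∣p∣+∣q∣ (outside ∷ p) (inside  ∷ q) =
  subst (suc ∣ p ∪ q ∣ ≤_) (sym (ℕ.+-suc ∣ p ∣ ∣ q ∣)) (s≤s (∣p∪q∣≤∣p∣+∣q∣ p q))
∣p∪q∣≤∣p∣+∣q∣ (inside  ∷ p) (outside ∷ q) = s≤s (∣p∪q∣≤∣p∣+∣q∣ p q)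
∣p∪q∣≤∣p∣+∣q∣ (inside  ∷ p) (inside  ∷ q) =
  s≤s (ℕ.≤-trans (∣p∪q∣≤∣p∣+∣q∣ p q) (ℕ.+-monoʳ-≤ ∣ p ∣ (ℕ.n≤1+n ∣ q ∣)))

∣⁅x⁆∪⁅y⁆∣≤2 : ∀ {n} (x y : Fin n) → ∣ ⁅ x ⁆ ∪ ⁅ y ⁆ ∣ ≤ 2
∣⁅x⁆∪⁅y⁆∣≤2 x y = subst₂ (λ a b → ∣ ⁅ x ⁆ ∪ ⁅ y ⁆ ∣ ≤ a + b)
  (Subset.∣⁅x⁆∣≡1 x) (Subset.∣⁅x⁆∣≡1 y) (∣p∪q∣≤∣p∣+∣q∣ ⁅ x ⁆ ⁅ y ⁆)

module _ {n : ℕ} (G : Graph n) where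
  open Graph G

  -- A legal sequence in reverse order: each pair consists of a vertex and a
  -- term that newly dominates it, so appending a term becomes _∷_.
  Footprinted : ∀ {k} → Vec (Fin n × Fin n) k → Set
  Footprinted W =
    All (λ (x , y) → Adj x y) W ×
    AllPairs (λ (x , _) (_ , y) → ¬ Adj x y) W

  footprinted-∷ : ∀ {k x y} {W : Vec (Fin n × Fin n) k} → Adj x y →
                  All (λ (_ , y′) → ¬ Adj x y′) W → Footprinted W →
                  Footprinted ((x , y) ∷ W)
  footprinted-∷ xy new (adj , fresh) = xy ∷ adj , new ∷ fresh

  module _ {k} (W : Vec (Fin n × Fin n) k) where

    -- The head of `W` is the pair added last, so `opposite` restores the order of the sequence.
    term : Fin k → Fin n
    term i = proj₂ (lookup W (opposite i))

    terms : Vec (Fin n) k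
    terms = tabulate term

    ∈-terms : ∀ i → proj₂ (lookup W i) ∈ᵛ terms
    ∈-terms i = subst (λ j → proj₂ (lookup W j) ∈ᵛ terms)
      (Fin.opposite-involutive i) (∈-tabulate⁺ term (opposite i))

    -- The first component of each pair witnesses the legality of its term. Distinctness comes for
    -- free: if a term were repeated, the footprint of the later copy would be adjacent to the
    -- earlier one.
    footprinted⇒legal : Footprinted W → IsLegal G terms
    footprinted⇒legal (adj , fresh) = Unique.tabulate⁺ term-injective , λ i _ →
      footprint i ,
      subst (λ y → Adj y (footprint i)) (sym (lookup∘tabulate term i))
        (symm (footprint-adj i)) ,
      λ j j<i a → footprint-fresh j<i
        (symm (subst (λ y → Adj y (footprint i)) (lookup∘tabulate term j) a))
      where
      footprint : Fin k → Fin n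
      footprint i = proj₁ (lookup W (opposite i))

      footprint-adj : ∀ i → Adj (footprint i) (term i)
      footprint-adj i = All.lookup⁺ adj (opposite i)

      footprint-fresh : ∀ {i j} → j Fin.< i → ¬ Adj (footprint i) (term j)
      -- An earlier term sits deeper in `W`, and `AllPairs` relates each pair to those behind it.
      footprint-fresh j<i = AllPairs-lookup fresh (opposite-anti-< j<i)

      term-injective : ∀ {i j} → term i ≡ term j → i ≡ j
      term-injective {i} {j} eq with Fin.<-cmp i j
      ... | tri< i<j _ _ = contradiction
        (subst (Adj (footprint j)) (sym eq) (footprint-adj j))
        (footprint-fresh i<j)
      ... | tri≈ _ i≡j _ = i≡j
      ... | tri> _ _ j<i = contradiction
        (subst (Adj (footprint i)) eq (footprint-adj i))
        (footprint-fresh j<i)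

  module _ (noIsolated : NoIsolatedVertices G) where
    open VecMembership (Fin._≟_ {n}) using (_∈?_)

    private
      γₜ  = totalDominationNumber G noIsolated
      γᵍʳ = grundyTotalDominationNumber G noIsolated

    -- The fuel m bounds how often W can still be extended.
    footprinted⇒k≤γᵍʳ : ∀ m {k} (W : Vec (Fin n × Fin n) k) → Footprinted W →
                        n < m + k → k ≤ γᵍʳ
    -- Without fuel `k` exceeds `n`, which is impossible for a sequence of distinct vertices.
    footprinted⇒k≤γᵍʳ zero W fp n<k =
      contradiction (legal-length≤n G (footprinted⇒legal W fp)) (ℕ.<⇒≱ n<k)
    footprinted⇒k≤γᵍʳ (suc m) {k} W fp n<m+k
      with Fin.all? (λ x → Fin.any? λ y → adj? x y ×-dec (y ∈? terms W))
    ... | yes dominating =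
      proj₂ (proj₂ (maximumTotalDominatingSequence G noIsolated))
        (terms W , footprinted⇒legal W fp , dominating)
    ... | no ¬dominating
      with Fin.¬∀⟶∃¬ n _
             (λ x → Fin.any? λ y → adj? x y ×-dec (y ∈? terms W)) ¬dominating
    ...   | x , undominated =
      -- No term is adjacent to `x`, so any neighbor `y` of `x` can be appended, with `x` as its
      -- footprint.
      let y , xy = noIsolated x in
      ℕ.<⇒≤ (footprinted⇒k≤γᵍʳ m ((x , y) ∷ W)
        (footprinted-∷ xy
          (All.lookup⁻ λ i a → undominated (_ , a , ∈-terms W i)) fp)
        (subst (n <_) (sym (ℕ.+-suc m k)) n<m+k))

    -- In the graph without vertices the empty set is total dominating, which would give `γₜ` the
    -- value 0.
    γₜ>0⇒vertex : γₜ > 0 → Fin n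
    γₜ>0⇒vertex γₜ>0 with Fin.any? {P = λ (_ : Fin n) → Fin n} yes
    ... | yes (v , _) = v
    ... | no empty = contradiction
      (proj₂ (proj₂ (minimumTotalDominatingSet G noIsolated))
        (Subset.⊥ , (λ v → contradiction (v , v) empty) , Subset.∣⊥∣≡0 n))
      (ℕ.<⇒≱ γₜ>0)

    -- Otherwise `⁅ u ⁆ ∪ ⁅ v ⁆` would be a total dominating set of size at most 2.
    γₜ>2⇒undominated : γₜ > 2 → ∀ u v → ∃ λ w → ¬ Adj w u × ¬ Adj w v
    γₜ>2⇒undominated γₜ>2 u v
      with Fin.any? (λ w → ¬? (adj? w u) ×-dec ¬? (adj? w v))
    ... | yes found = found
    ... | no ¬found = contradiction
      (ℕ.≤-trans
        (proj₂ (proj₂ (minimumTotalDominatingSet G noIsolated))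
          (⁅ u ⁆ ∪ ⁅ v ⁆ , dominating , refl))
        (∣⁅x⁆∪⁅y⁆∣≤2 u v))
      (ℕ.<⇒≱ γₜ>2)
      where
      dominating : IsTotalDominating G (Subset._∈ ⁅ u ⁆ ∪ ⁅ v ⁆)
      dominating w with adj? w u | adj? w v
      ... | yes wu | _      = u , wu , Subset.x∈p∪q⁺ (inj₁ (Subset.x∈⁅x⁆ u))
      ... | no _   | yes wv = v , wv , Subset.x∈p∪q⁺ (inj₂ (Subset.x∈⁅x⁆ v))
      ... | no ¬wu | no ¬wv = contradiction (w , ¬wu , ¬wv) ¬found

    γₜ>2⇒γᵍʳ>3 : γₜ > 2 → γᵍʳ > 3
    γₜ>2⇒γᵍʳ>3 γₜ>2 =
      let u , vu        = noIsolated v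
          w , ¬wv , ¬wu = γₜ>2⇒undominated γₜ>2 v u
          z , wz        = noIsolated w
      in footprinted⇒k≤γᵍʳ (suc n)
           -- From right to left, the second components spell the sequence `w`, `u`, `v`, `z`.
           -- Freshness needs only that `w` is adjacent to neither `u` nor `v`, and irreflexivity at
           -- `w` and `u`.
           ((w , z) ∷ (u , v) ∷ (v , u) ∷ (z , w) ∷ [])
           (footprinted-∷ wz (¬wv ∷ ¬wu ∷ irrefl refl ∷ [])
             (footprinted-∷ (symm vu) (irrefl refl ∷ (λ uw → ¬wu (symm uw)) ∷ [])
               (footprinted-∷ vu ((λ vw → ¬wv (symm vw)) ∷ [])
                 (footprinted-∷ (symm wz) [] ([] , [])))))
           -- The 4 is the length of the starting sequence; fuel `suc n` makes the required bound
           -- immediate.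
           (ℕ.m≤m+n (suc n) 4)
      where
      v = γₜ>0⇒vertex (ℕ.≤-trans (s≤s z≤n) γₜ>2)

mainTheorem3 : ∀ (n : ℕ) (G : Graph n) (noIsolated : NoIsolatedVertices G) →
    totalDominationNumber G noIsolated ≡ 3 →
    grundyTotalDominationNumber G noIsolated > 3
mainTheorem3 n G noIsolated γₜ≡3 =
  γₜ>2⇒γᵍʳ>3 G noIsolated (subst (2 <_) (sym γₜ≡3) ℕ.≤-refl)
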